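{- Let $\mathbf{SMC}$ be the category of symmetric strict monoidal categories and strict symmetric monoidal functors, and $\mathbf{UTSMC}$ the category of uniformly traced symmetric strict monoidal categories and trace-preserving strict symmetric monoidal functors. The forgetful functor $U\colon\mathbf{UTSMC}\to\mathbf{SMC}$ has a left adjoint.
   Context: Composition is diagrammatic. A traced symmetric strict monoidal category carries operators $\mathsf{tr}_S\colon\mathcal{C}(S\otimes X,S\otimes Y)\to\mathcal{C}(X,Y)$ satisfying the standard trace axioms (tightening $\mathsf{tr}_S((\mathrm{id}\otimes u);f;(\mathrm{id}\otimes v))=u;\mathsf{tr}_Sf;v$, strength $\mathsf{tr}_S(f\otimes g)=\mathsf{tr}_Sf\otimes g$, joining $\mathsf{tr}_T\mathsf{tr}_Sf=\mathsf{tr}_{S\otimes T}f$, vanishing $\mathsf{tr}_If=f$, sliding $\mathsf{tr}_T(f;(u\otimes\mathrm{id}))=\mathsf{tr}_S((u\otimes\mathrm{id});f)$, yanking $\mathsf{tr}_S\sigma_{S,S}=\mathrm{id}_S$). The trace is uniform if, for all $f\colon S\otimes X\to S\otimes Y$, $g\colon T\otimes X\to T\otimes Y$, $r\colon S\to T$, the equation $f;(r\otimes\mathrm{id}_Y)=(r\otimes\mathrm{id}_X);g$ implies $\mathsf{tr}_Sf=\mathsf{tr}_Tg$. -}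

module Defs where

open import Level using (Level; suc)
open import Relation.Binary.PropositionalEquality using (_≡_; refl; sym)
open import Relation.Binary.Structures using (IsEquivalence)
open import Data.Product using (Σ; _×_)

-- Objects form a set (UIP on objects), as in set-based category theory;
-- this is what makes "strict" (equations between objects) meaningful.

record Category (ℓ : Level) : Set (suc ℓ) where
  infixr 9 _⨾_
  infix 4 _≈_
  field
    Obj       : Set ℓ
    Obj-isSet : {A B : Obj} (p q : A ≡ B) → p ≡ q
    _⇒_       : Obj → Obj → Set ℓ
    _≈_       : {A B : Obj} → A ⇒ B → A ⇒ B → Set ℓ
    ≈-equiv   : {A B : Obj} → IsEquivalence (_≈_ {A} {B})
    id        : {A : Obj} → A ⇒ A
    _⨾_       : {A B C : Obj} → A ⇒ B → B ⇒ C → A ⇒ C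
    ⨾-resp-≈  : {A B C : Obj} {f f' : A ⇒ B} {g g' : B ⇒ C} →
                f ≈ f' → g ≈ g' → f ⨾ g ≈ f' ⨾ g'
    identityˡ : {A B : Obj} {f : A ⇒ B} → id ⨾ f ≈ f
    identityʳ : {A B : Obj} {f : A ⇒ B} → f ⨾ id ≈ f
    assoc     : {A B C D : Obj} {f : A ⇒ B} {g : B ⇒ C} {h : C ⇒ D} →
                (f ⨾ g) ⨾ h ≈ f ⨾ (g ⨾ h)

  ≡⇒ : {A B : Obj} → A ≡ B → A ⇒ B
  ≡⇒ refl = id

record SMC (ℓ : Level) : Set (suc ℓ) where
  field
    category : Category ℓ
  open Category category public
  infixr 10 _⊗₀_ _⊗₁_
  field
    _⊗₀_  : Obj → Obj → Obj
    I     : Obj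
    _⊗₁_  : {A B C D : Obj} → A ⇒ B → C ⇒ D → (A ⊗₀ C) ⇒ (B ⊗₀ D)
    ⊗-resp-≈ : {A B C D : Obj} {f f' : A ⇒ B} {g g' : C ⇒ D} →
               f ≈ f' → g ≈ g' → f ⊗₁ g ≈ f' ⊗₁ g'
    ⊗-id  : {A B : Obj} → id {A} ⊗₁ id {B} ≈ id
    ⊗-⨾   : {A B C D E F : Obj} {f : A ⇒ B} {g : B ⇒ C} {h : D ⇒ E} {k : E ⇒ F} →
            (f ⨾ g) ⊗₁ (h ⨾ k) ≈ (f ⊗₁ h) ⨾ (g ⊗₁ k)
    ⊗-assoc₀ : {A B C : Obj} → (A ⊗₀ B) ⊗₀ C ≡ A ⊗₀ (B ⊗₀ C)
    unitˡ₀   : {A : Obj} → I ⊗₀ A ≡ A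
    unitʳ₀   : {A : Obj} → A ⊗₀ I ≡ A
    ⊗-assoc₁ : {A B C D E F : Obj} {f : A ⇒ B} {g : C ⇒ D} {h : E ⇒ F} →
               ≡⇒ (sym ⊗-assoc₀) ⨾ ((f ⊗₁ g) ⊗₁ h) ⨾ ≡⇒ ⊗-assoc₀ ≈ f ⊗₁ (g ⊗₁ h)
    unitˡ₁   : {A B : Obj} {f : A ⇒ B} →
               ≡⇒ (sym unitˡ₀) ⨾ (id {I} ⊗₁ f) ⨾ ≡⇒ unitˡ₀ ≈ f
    unitʳ₁   : {A B : Obj} {f : A ⇒ B} →
               ≡⇒ (sym unitʳ₀) ⨾ (f ⊗₁ id {I}) ⨾ ≡⇒ unitʳ₀ ≈ f
    σ            : {A B : Obj} → (A ⊗₀ B) ⇒ (B ⊗₀ A)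
    σ-natural    : {A B C D : Obj} {f : A ⇒ B} {g : C ⇒ D} →
                   (f ⊗₁ g) ⨾ σ ≈ σ ⨾ (g ⊗₁ f)
    σ-involutive : {A B : Obj} → σ {A} {B} ⨾ σ {B} {A} ≈ id
    σ-hexagon    : {A B C : Obj} →
                   σ {A} {B ⊗₀ C} ≈
                   ≡⇒ (sym ⊗-assoc₀) ⨾ (σ {A} {B} ⊗₁ id {C}) ⨾ ≡⇒ ⊗-assoc₀
                     ⨾ (id {B} ⊗₁ σ {A} {C}) ⨾ ≡⇒ (sym ⊗-assoc₀)

record UTSMC (ℓ : Level) : Set (suc ℓ) where
  field
    smc : SMC ℓ
  open SMC smc public
  field
    tr          : {S X Y : Obj} → (S ⊗₀ X) ⇒ (S ⊗₀ Y) → X ⇒ Y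
    tr-resp-≈   : {S X Y : Obj} {f g : (S ⊗₀ X) ⇒ (S ⊗₀ Y)} → f ≈ g → tr f ≈ tr g
    tightening  : {S X X' Y Y' : Obj} (u : X' ⇒ X) (f : (S ⊗₀ X) ⇒ (S ⊗₀ Y)) (v : Y ⇒ Y') →
                  tr ((id {S} ⊗₁ u) ⨾ f ⨾ (id {S} ⊗₁ v)) ≈ u ⨾ tr f ⨾ v
    strength    : {S X Y Z W : Obj} (f : (S ⊗₀ X) ⇒ (S ⊗₀ Y)) (g : Z ⇒ W) →
                  tr {S} (≡⇒ (sym ⊗-assoc₀) ⨾ (f ⊗₁ g) ⨾ ≡⇒ ⊗-assoc₀) ≈ tr f ⊗₁ g
    joining     : {S T X Y : Obj} (f : (S ⊗₀ (T ⊗₀ X)) ⇒ (S ⊗₀ (T ⊗₀ Y))) →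
                  tr {T} (tr {S} f) ≈ tr {S ⊗₀ T} (≡⇒ ⊗-assoc₀ ⨾ f ⨾ ≡⇒ (sym ⊗-assoc₀))
    vanishing   : {X Y : Obj} (f : (I ⊗₀ X) ⇒ (I ⊗₀ Y)) →
                  tr {I} f ≈ ≡⇒ (sym unitˡ₀) ⨾ f ⨾ ≡⇒ unitˡ₀
    sliding     : {S T X Y : Obj} (f : (T ⊗₀ X) ⇒ (S ⊗₀ Y)) (u : S ⇒ T) →
                  tr {T} (f ⨾ (u ⊗₁ id {Y})) ≈ tr {S} ((u ⊗₁ id {X}) ⨾ f)
    yanking     : {S : Obj} → tr {S} (σ {S} {S}) ≈ id {S}
    uniform     : {S T X Y : Obj} (f : (S ⊗₀ X) ⇒ (S ⊗₀ Y)) (g : (T ⊗₀ X) ⇒ (T ⊗₀ Y))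
                  (r : S ⇒ T) →
                  f ⨾ (r ⊗₁ id {Y}) ≈ (r ⊗₁ id {X}) ⨾ g → tr f ≈ tr g

module _ {ℓ : Level} (C D : SMC ℓ) where
  private
    module C = SMC C
    module D = SMC D

  record SMFunctor : Set ℓ where
    field
      F₀     : C.Obj → D.Obj
      F₁     : {A B : C.Obj} → A C.⇒ B → F₀ A D.⇒ F₀ B
      F-resp : {A B : C.Obj} {f g : A C.⇒ B} → f C.≈ g → F₁ f D.≈ F₁ g
      F-id   : {A : C.Obj} → F₁ (C.id {A}) D.≈ D.id
      F-⨾    : {A B E : C.Obj} {f : A C.⇒ B} {g : B C.⇒ E} →
               F₁ (f C.⨾ g) D.≈ F₁ f D.⨾ F₁ g
      F-⊗₀   : {A B : C.Obj} → F₀ (A C.⊗₀ B) ≡ F₀ A D.⊗₀ F₀ B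
      F-I    : F₀ C.I ≡ D.I
      F-⊗₁   : {A B E G : C.Obj} {f : A C.⇒ B} {g : E C.⇒ G} →
               F₁ (f C.⊗₁ g) D.≈ D.≡⇒ F-⊗₀ D.⨾ (F₁ f D.⊗₁ F₁ g) D.⨾ D.≡⇒ (sym F-⊗₀)
      F-σ    : {A B : C.Obj} →
               F₁ (C.σ {A} {B}) D.≈ D.≡⇒ F-⊗₀ D.⨾ D.σ D.⨾ D.≡⇒ (sym F-⊗₀)

module _ {ℓ : Level} (C D : UTSMC ℓ) where
  private
    module C = UTSMC C
    module D = UTSMC D

  record TFunctor : Set ℓ where
    field
      smf : SMFunctor C.smc D.smc
    open SMFunctor smf public
    field
      F-tr : {S X Y : C.Obj} {f : (S C.⊗₀ X) C.⇒ (S C.⊗₀ Y)} →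
             F₁ (C.tr f) D.≈ D.tr (D.≡⇒ (sym F-⊗₀) D.⨾ F₁ f D.⨾ D.≡⇒ F-⊗₀)

  _≐_ : TFunctor → TFunctor → Set ℓ
  H ≐ H' = Σ ((A : C.Obj) → H.F₀ A ≡ H'.F₀ A) λ e →
           {A B : C.Obj} (f : A C.⇒ B) →
           H.F₁ f D.⨾ D.≡⇒ (e B) D.≈ D.≡⇒ (e A) D.⨾ H'.F₁ f
    where
      module H  = TFunctor H
      module H' = TFunctor H'

-- The forgetful functor U : UTSMC → SMC (on objects: UTSMC.smc, on
-- morphisms: TFunctor.smf) and the universal-arrow formulation of
-- "U has a left adjoint".

Factors : {ℓ : Level} {C : SMC ℓ} {F D : UTSMC ℓ} →
          SMFunctor C (UTSMC.smc F) → TFunctor F D → SMFunctor C (UTSMC.smc D) → Set ℓ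
Factors {C = C} {F} {D} η H G =
  Σ ((A : SMC.Obj C) → H.F₀ (η.F₀ A) ≡ G.F₀ A) λ e →
  {A B : SMC.Obj C} (f : SMC._⇒_ C A B) →
  UTSMC._≈_ D (UTSMC._⨾_ D (H.F₁ (η.F₁ f)) (UTSMC.≡⇒ D (e B)))
              (UTSMC._⨾_ D (UTSMC.≡⇒ D (e A)) (G.F₁ f))
  where
    module η = SMFunctor η
    module H = TFunctor H
    module G = SMFunctor G

record UniversalArrow {ℓ : Level} (C : SMC ℓ) : Set (suc ℓ) where
  field
    F       : UTSMC ℓ
    η       : SMFunctor C (UTSMC.smc F)
    factor  : (D : UTSMC ℓ) (G : SMFunctor C (UTSMC.smc D)) → TFunctor F D
    factors : (D : UTSMC ℓ) (G : SMFunctor C (UTSMC.smc D)) → Factors η (factor D G) G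
    unique  : (D : UTSMC ℓ) (G : SMFunctor C (UTSMC.smc D)) (H : TFunctor F D) →
              Factors η H G → _≐_ F D H (factor D G)

-- U : UTSMC ℓ → SMC ℓ has a left adjoint  (Mac Lane, CWM Thm IV.1.2:
-- a functor has a left adjoint iff every object has a universal arrow to it).
ForgetfulHasLeftAdjoint : (ℓ : Level) → Set (suc ℓ)
ForgetfulHasLeftAdjoint ℓ = (C : SMC ℓ) → UniversalArrow C

{-# OPTIONS --safe #-}
module Submission where

open import Defs
open import Level using (Level)
open import Relation.Binary.PropositionalEquality using (_≡_; refl; sym; cong)
open import Relation.Binary.Structures using (IsEquivalence)
open import Data.Product using (_,_)

-- The left adjoint is the syntactic free uniformly traced category on C. Its
-- objects are those of C; its morphisms are terms built from the morphisms of C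
-- by id, ⨾, ⊗, σ and tr, modulo the least congruence containing the equations of
-- a traced symmetric strict monoidal category, the equations making the
-- inclusion ⌜_⌝ of C a strict symmetric monoidal functor, and the uniformity
-- rule. Uniformity is a Horn clause rather than an equation, but the congruence
-- is generated inductively, so it is closed under it all the same. Any
-- G : C → U D extends to terms by structural recursion; this respects the
-- congruence because every generating rule holds in D, and any trace-preserving
-- H with U H ∘ η = G agrees with the extension by induction on terms.

-- A strict monoidal functor G preserves ⊗ only up to an equality of objects
-- G (A ⊗ B) ≡ G A ⊗ G B, so the structure of a target category is needed
-- conjugated by such equalities. Stating the laws with all these equalities as
-- variables lets them be proved by matching on refl; the equalities that remain
-- fixed (associator, unitors) are identified by Obj-isSet.
module Transport {ℓ : Level} (D : SMC ℓ) where
  open SMC D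

  module ≈ {A B : Obj} = IsEquivalence (≈-equiv {A} {B})

  identityˡʳ : {A B : Obj} {k : A ⇒ B} → id ⨾ k ⨾ id ≈ k
  identityˡʳ = ≈.trans identityˡ identityʳ

  ⊗[_,_] : {X Y a b c d : Obj} → X ≡ a ⊗₀ b → Y ≡ c ⊗₀ d → a ⇒ c → b ⇒ d → X ⇒ Y
  ⊗[ e , e' ] f g = ≡⇒ e ⨾ (f ⊗₁ g) ⨾ ≡⇒ (sym e')

  σ[_,_] : {X Y a b : Obj} → X ≡ a ⊗₀ b → Y ≡ b ⊗₀ a → X ⇒ Y
  σ[ e , e' ] = ≡⇒ e ⨾ σ ⨾ ≡⇒ (sym e')

  ⊗[]-resp-≈ : {X Y a b c d : Obj} (e : X ≡ a ⊗₀ b) (e' : Y ≡ c ⊗₀ d)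
               {f f' : a ⇒ c} {g g' : b ⇒ d} →
               f ≈ f' → g ≈ g' → ⊗[ e , e' ] f g ≈ ⊗[ e , e' ] f' g'
  ⊗[]-resp-≈ e e' p q = ⨾-resp-≈ ≈.refl (⨾-resp-≈ (⊗-resp-≈ p q) ≈.refl)

  ⊗[]-id : {X a b : Obj} (e : X ≡ a ⊗₀ b) → ⊗[ e , e ] (id {a}) (id {b}) ≈ id
  ⊗[]-id refl = ≈.trans identityˡʳ ⊗-id

  ⊗[]-⨾ : {X₁ X₂ X₃ a₁ a₂ a₃ b₁ b₂ b₃ : Obj}
          (e₁ : X₁ ≡ a₁ ⊗₀ b₁) (e₂ : X₂ ≡ a₂ ⊗₀ b₂) (e₃ : X₃ ≡ a₃ ⊗₀ b₃)
          (f : a₁ ⇒ a₂) (g : a₂ ⇒ a₃) (h : b₁ ⇒ b₂) (k : b₂ ⇒ b₃) →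
          ⊗[ e₁ , e₃ ] (f ⨾ g) (h ⨾ k) ≈ ⊗[ e₁ , e₂ ] f h ⨾ ⊗[ e₂ , e₃ ] g k
  ⊗[]-⨾ refl refl refl f g h k =
    ≈.trans identityˡʳ (≈.trans ⊗-⨾ (≈.sym (⨾-resp-≈ identityˡʳ identityˡʳ)))

  ⊗[]-assoc : {a b c a' b' c' X₁ X₂ Y₁ Y₂ X₁' X₂' Y₁' Y₂' : Obj}
              (f : a ⇒ a') (g : b ⇒ b') (h : c ⇒ c') (s : Y₁ ≡ X₁) (s' : X₁' ≡ Y₁')
              (e₁ : X₁ ≡ X₂ ⊗₀ c) (e₂ : X₂ ≡ a ⊗₀ b) (e₁' : X₁' ≡ X₂' ⊗₀ c') (e₂' : X₂' ≡ a' ⊗₀ b')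
              (d₁ : Y₁ ≡ a ⊗₀ Y₂) (d₂ : Y₂ ≡ b ⊗₀ c) (d₁' : Y₁' ≡ a' ⊗₀ Y₂') (d₂' : Y₂' ≡ b' ⊗₀ c') →
              ≡⇒ s ⨾ ⊗[ e₁ , e₁' ] (⊗[ e₂ , e₂' ] f g) h ⨾ ≡⇒ s' ≈ ⊗[ d₁ , d₁' ] f (⊗[ d₂ , d₂' ] g h)
  ⊗[]-assoc f g h s s' refl refl refl refl refl refl refl refl
    rewrite Obj-isSet s (sym ⊗-assoc₀) | Obj-isSet s' ⊗-assoc₀ =
    ≈.trans (⨾-resp-≈ ≈.refl (⨾-resp-≈ (≈.trans identityˡʳ (⊗-resp-≈ identityˡʳ ≈.refl)) ≈.refl))
            (≈.trans ⊗-assoc₁ (≈.sym (≈.trans identityˡʳ (⊗-resp-≈ ≈.refl identityˡʳ))))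

  ⊗[]-unitˡ : {a a' J X X' : Obj} (f : a ⇒ a') → J ≡ I →
              (s : a ≡ X) (e : X ≡ J ⊗₀ a) (e' : X' ≡ J ⊗₀ a') (s' : X' ≡ a') →
              ≡⇒ s ⨾ ⊗[ e , e' ] id f ⨾ ≡⇒ s' ≈ f
  ⊗[]-unitˡ f refl s refl refl s' rewrite Obj-isSet s (sym unitˡ₀) | Obj-isSet s' unitˡ₀ =
    ≈.trans (⨾-resp-≈ ≈.refl (⨾-resp-≈ identityˡʳ ≈.refl)) unitˡ₁

  ⊗[]-unitʳ : {a a' J X X' : Obj} (f : a ⇒ a') → J ≡ I →
              (s : a ≡ X) (e : X ≡ a ⊗₀ J) (e' : X' ≡ a' ⊗₀ J) (s' : X' ≡ a') →
              ≡⇒ s ⨾ ⊗[ e , e' ] f id ⨾ ≡⇒ s' ≈ f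
  ⊗[]-unitʳ f refl s refl refl s' rewrite Obj-isSet s (sym unitʳ₀) | Obj-isSet s' unitʳ₀ =
    ≈.trans (⨾-resp-≈ ≈.refl (⨾-resp-≈ identityˡʳ ≈.refl)) unitʳ₁

  σ[]-natural : {X₁ X₂ X₃ X₄ a b c d : Obj}
                (e₁ : X₁ ≡ a ⊗₀ c) (e₂ : X₂ ≡ b ⊗₀ d) (e₃ : X₃ ≡ d ⊗₀ b) (e₄ : X₄ ≡ c ⊗₀ a)
                (f : a ⇒ b) (g : c ⇒ d) →
                ⊗[ e₁ , e₂ ] f g ⨾ σ[ e₂ , e₃ ] ≈ σ[ e₁ , e₄ ] ⨾ ⊗[ e₄ , e₃ ] g f
  σ[]-natural refl refl refl refl f g =
    ≈.trans (⨾-resp-≈ identityˡʳ identityˡʳ)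
            (≈.trans σ-natural (≈.sym (⨾-resp-≈ identityˡʳ identityˡʳ)))

  σ[]-involutive : {X₁ X₂ a b : Obj} (e₁ : X₁ ≡ a ⊗₀ b) (e₂ : X₂ ≡ b ⊗₀ a) →
                   σ[ e₁ , e₂ ] ⨾ σ[ e₂ , e₁ ] ≈ id
  σ[]-involutive refl refl = ≈.trans (⨾-resp-≈ identityˡʳ identityˡʳ) σ-involutive

  σ[]-hexagon : {a b c X₀ Y₂ Z₀ P₁ P₂ Q₁ Q₂ R₁ R₂ W₁ W₂ : Obj}
                (e₁ : X₀ ≡ a ⊗₀ Y₂) (e₁' : Z₀ ≡ Y₂ ⊗₀ a) (e₂ : Y₂ ≡ b ⊗₀ c)
                (f₁ : P₁ ≡ P₂ ⊗₀ c) (f₂ : P₂ ≡ a ⊗₀ b) (f₁' : Q₁ ≡ Q₂ ⊗₀ c) (f₂' : Q₂ ≡ b ⊗₀ a)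
                (g₁ : R₁ ≡ b ⊗₀ R₂) (g₂ : R₂ ≡ a ⊗₀ c) (g₁' : W₁ ≡ b ⊗₀ W₂) (g₂' : W₂ ≡ c ⊗₀ a)
                (s₁ : X₀ ≡ P₁) (s₂ : Q₁ ≡ R₁) (s₃ : W₁ ≡ Z₀) →
                σ[ e₁ , e₁' ] ≈
                ≡⇒ s₁ ⨾ ⊗[ f₁ , f₁' ] σ[ f₂ , f₂' ] id ⨾ ≡⇒ s₂ ⨾ ⊗[ g₁ , g₁' ] id σ[ g₂ , g₂' ] ⨾ ≡⇒ s₃
  σ[]-hexagon refl refl refl refl refl refl refl refl refl refl refl s₁ s₂ s₃
    rewrite Obj-isSet s₁ (sym ⊗-assoc₀) | Obj-isSet s₂ ⊗-assoc₀ | Obj-isSet s₃ (sym ⊗-assoc₀) =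
    ≈.trans identityˡʳ (≈.trans σ-hexagon (≈.sym
      (⨾-resp-≈ ≈.refl (⨾-resp-≈ (≈.trans identityˡʳ (⊗-resp-≈ identityˡʳ ≈.refl))
        (⨾-resp-≈ ≈.refl (⨾-resp-≈ (≈.trans identityˡʳ (⊗-resp-≈ ≈.refl identityˡʳ)) ≈.refl))))))

  record _≈[_∣_]_ {A B A' B' : Obj} (k : A ⇒ B) (p : A ≡ A') (q : B ≡ B') (k' : A' ⇒ B') : Set ℓ where
    constructor square
    field commutes : k ⨾ ≡⇒ q ≈ ≡⇒ p ⨾ k'
  open _≈[_∣_]_ public

  ≈-to-≈[] : {A B : Obj} {k k' : A ⇒ B} → k ≈ k' → k ≈[ refl ∣ refl ] k'
  ≈-to-≈[] k≈k' = square (≈.trans identityʳ (≈.trans k≈k' (≈.sym identityˡ)))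

  ≈[]-to-≈ : {A B : Obj} {k k' : A ⇒ B} → k ≈[ refl ∣ refl ] k' → k ≈ k'
  ≈[]-to-≈ (square c) = ≈.trans (≈.sym identityʳ) (≈.trans c identityˡ)

  ≈[]-respˡ : {A B A' B' : Obj} {p : A ≡ A'} {q : B ≡ B'} {k₁ k₂ : A ⇒ B} {k' : A' ⇒ B'} →
              k₁ ≈ k₂ → k₂ ≈[ p ∣ q ] k' → k₁ ≈[ p ∣ q ] k'
  ≈[]-respˡ k₁≈k₂ (square c) = square (≈.trans (⨾-resp-≈ k₁≈k₂ ≈.refl) c)

  ≈[]-id : {A A' : Obj} (p : A ≡ A') → id ≈[ p ∣ p ] id
  ≈[]-id refl = ≈-to-≈[] ≈.refl

  ≈[]-⨾ : {A B E A' B' E' : Obj} {p : A ≡ A'} {q : B ≡ B'} {r : E ≡ E'}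
          {k : A ⇒ B} {k' : A' ⇒ B'} {l : B ⇒ E} {l' : B' ⇒ E'} →
          k ≈[ p ∣ q ] k' → l ≈[ q ∣ r ] l' → (k ⨾ l) ≈[ p ∣ r ] (k' ⨾ l')
  ≈[]-⨾ {p = refl} {refl} {refl} k≈k' l≈l' =
    ≈-to-≈[] (⨾-resp-≈ (≈[]-to-≈ k≈k') (≈[]-to-≈ l≈l'))

  ≈[]-⊗ : {x y z w x' y' z' w' X Y X' Y' : Obj}
          (a : X ≡ x ⊗₀ z) (b : Y ≡ y ⊗₀ w) (a' : X' ≡ x' ⊗₀ z') (b' : Y' ≡ y' ⊗₀ w')
          {r : X ≡ X'} {s : Y ≡ Y'} {p : x ≡ x'} {q : y ≡ y'} {p₂ : z ≡ z'} {q₂ : w ≡ w'}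
          {k : x ⇒ y} {k' : x' ⇒ y'} {l : z ⇒ w} {l' : z' ⇒ w'} →
          k ≈[ p ∣ q ] k' → l ≈[ p₂ ∣ q₂ ] l' → ⊗[ a , b ] k l ≈[ r ∣ s ] ⊗[ a' , b' ] k' l'
  ≈[]-⊗ refl refl refl refl {refl} {refl} {refl} {refl} {refl} {refl} k≈k' l≈l' =
    ≈-to-≈[] (⊗[]-resp-≈ refl refl (≈[]-to-≈ k≈k') (≈[]-to-≈ l≈l'))

  ≈[]-σ : {x z x' z' X Y X' Y' : Obj}
          (a : X ≡ x ⊗₀ z) (b : Y ≡ z ⊗₀ x) (a' : X' ≡ x' ⊗₀ z') (b' : Y' ≡ z' ⊗₀ x')
          {r : X ≡ X'} {s : Y ≡ Y'} → x ≡ x' → z ≡ z' → σ[ a , b ] ≈[ r ∣ s ] σ[ a' , b' ]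
  ≈[]-σ refl refl refl refl {refl} {refl} refl refl = ≈-to-≈[] ≈.refl

module TraceTransport {ℓ : Level} (D : UTSMC ℓ) where
  open UTSMC D
  open Transport smc

  tr[_,_] : {X Y s x y : Obj} → X ≡ s ⊗₀ x → Y ≡ s ⊗₀ y → X ⇒ Y → x ⇒ y
  tr[ e , e' ] k = tr (≡⇒ (sym e) ⨾ k ⨾ ≡⇒ e')

  tr[]-resp-≈ : {X Y s x y : Obj} (e : X ≡ s ⊗₀ x) (e' : Y ≡ s ⊗₀ y) {k k' : X ⇒ Y} →
                k ≈ k' → tr[ e , e' ] k ≈ tr[ e , e' ] k'
  tr[]-resp-≈ e e' k≈k' = tr-resp-≈ (⨾-resp-≈ ≈.refl (⨾-resp-≈ k≈k' ≈.refl))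

  tr[]-tightening : {s x x' y y' X₁ X₂ X₃ X₄ : Obj}
                    (e₁ : X₁ ≡ s ⊗₀ x') (e₂ : X₂ ≡ s ⊗₀ x) (e₃ : X₃ ≡ s ⊗₀ y) (e₄ : X₄ ≡ s ⊗₀ y')
                    (u : x' ⇒ x) (f : X₂ ⇒ X₃) (v : y ⇒ y') →
                    tr[ e₁ , e₄ ] (⊗[ e₁ , e₂ ] id u ⨾ f ⨾ ⊗[ e₃ , e₄ ] id v) ≈ u ⨾ tr[ e₂ , e₃ ] f ⨾ v
  tr[]-tightening refl refl refl refl u f v =
    ≈.trans (tr-resp-≈ (≈.trans identityˡʳ (⨾-resp-≈ identityˡʳ (⨾-resp-≈ ≈.refl identityˡʳ))))
            (≈.trans (tightening u f v) (⨾-resp-≈ ≈.refl (⨾-resp-≈ (tr-resp-≈ (≈.sym identityˡʳ)) ≈.refl)))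

  tr[]-strength : {s x y z w U₁ U₂ V₁ V₂ U₁' U₂' V₁' V₂' : Obj} (f : V₂ ⇒ V₂') (g : z ⇒ w)
                  (h₁ : U₁ ≡ s ⊗₀ U₂) (m : U₂ ≡ x ⊗₀ z) (t : U₁ ≡ V₁) (k₁ : V₁ ≡ V₂ ⊗₀ z) (n : V₂ ≡ s ⊗₀ x)
                  (h₁' : U₁' ≡ s ⊗₀ U₂') (m' : U₂' ≡ y ⊗₀ w) (t' : V₁' ≡ U₁') (k₁' : V₁' ≡ V₂' ⊗₀ w)
                  (n' : V₂' ≡ s ⊗₀ y) →
                  tr[ h₁ , h₁' ] (≡⇒ t ⨾ ⊗[ k₁ , k₁' ] f g ⨾ ≡⇒ t') ≈ ⊗[ m , m' ] (tr[ n , n' ] f) g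
  tr[]-strength f g refl refl t refl refl refl refl t' refl refl
    rewrite Obj-isSet t (sym ⊗-assoc₀) | Obj-isSet t' ⊗-assoc₀ =
    ≈.trans (tr-resp-≈ (≈.trans identityˡʳ (⨾-resp-≈ ≈.refl (⨾-resp-≈ identityˡʳ ≈.refl))))
            (≈.trans (strength f g) (≈.sym (≈.trans identityˡʳ (⊗-resp-≈ (tr-resp-≈ identityˡʳ) ≈.refl))))

  tr[]-joining : {s t x y U U' W W' R V V' : Obj} (f : W ⇒ W')
                 (p₂ : W ≡ s ⊗₀ U) (p₁ : U ≡ t ⊗₀ x) (p₂' : W' ≡ s ⊗₀ U') (p₁' : U' ≡ t ⊗₀ y)
                 (r : R ≡ s ⊗₀ t) (q : V ≡ R ⊗₀ x) (a : V ≡ W) (a' : W' ≡ V') (q' : V' ≡ R ⊗₀ y) →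
                 tr[ p₁ , p₁' ] (tr[ p₂ , p₂' ] f) ≈ tr[ q , q' ] (≡⇒ a ⨾ f ⨾ ≡⇒ a')
  tr[]-joining f refl refl refl refl refl refl a a' refl
    rewrite Obj-isSet a ⊗-assoc₀ | Obj-isSet a' (sym ⊗-assoc₀) =
    ≈.trans (tr-resp-≈ (≈.trans identityˡʳ (tr-resp-≈ identityˡʳ)))
            (≈.trans (joining f) (tr-resp-≈ (≈.sym identityˡʳ)))

  tr[]-vanishing : {x y J V V' : Obj} (f : V ⇒ V') → J ≡ I →
                   (e : V ≡ J ⊗₀ x) (e' : V' ≡ J ⊗₀ y) (s : x ≡ V) (s' : V' ≡ y) →
                   tr[ e , e' ] f ≈ ≡⇒ s ⨾ f ⨾ ≡⇒ s'
  tr[]-vanishing f refl refl refl s s' rewrite Obj-isSet s (sym unitˡ₀) | Obj-isSet s' unitˡ₀ =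
    ≈.trans (tr-resp-≈ identityˡʳ) (vanishing f)

  tr[]-sliding : {s t x y X₁ X₂ X₃ X₄ : Obj}
                 (e₁ : X₁ ≡ t ⊗₀ x) (e₂ : X₂ ≡ s ⊗₀ y) (e₃ : X₃ ≡ t ⊗₀ y) (e₄ : X₄ ≡ s ⊗₀ x)
                 (f : X₁ ⇒ X₂) (u : s ⇒ t) →
                 tr[ e₁ , e₃ ] (f ⨾ ⊗[ e₂ , e₃ ] u id) ≈ tr[ e₄ , e₂ ] (⊗[ e₄ , e₁ ] u id ⨾ f)
  tr[]-sliding refl refl refl refl f u =
    ≈.trans (tr-resp-≈ (≈.trans identityˡʳ (⨾-resp-≈ ≈.refl identityˡʳ)))
            (≈.trans (sliding f u) (tr-resp-≈ (≈.sym (≈.trans identityˡʳ (⨾-resp-≈ identityˡʳ ≈.refl)))))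

  tr[]-yanking : {s X : Obj} (e : X ≡ s ⊗₀ s) → tr[ e , e ] σ[ e , e ] ≈ id
  tr[]-yanking refl = ≈.trans (tr-resp-≈ (≈.trans identityˡʳ identityˡʳ)) yanking

  tr[]-uniform : {s t x y X₁ X₂ X₃ X₄ : Obj}
                 (e₁ : X₁ ≡ s ⊗₀ y) (e₂ : X₂ ≡ t ⊗₀ y) (e₃ : X₃ ≡ s ⊗₀ x) (e₄ : X₄ ≡ t ⊗₀ x)
                 (f : X₃ ⇒ X₁) (g : X₄ ⇒ X₂) (r : s ⇒ t) →
                 f ⨾ ⊗[ e₁ , e₂ ] r id ≈ ⊗[ e₃ , e₄ ] r id ⨾ g → tr[ e₃ , e₁ ] f ≈ tr[ e₄ , e₂ ] g
  tr[]-uniform refl refl refl refl f g r f⨾r≈r⨾g =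
    uniform _ _ r (≈.trans (⨾-resp-≈ identityˡʳ ≈.refl)
      (≈.trans (≈.trans (⨾-resp-≈ ≈.refl (≈.sym identityˡʳ)) f⨾r≈r⨾g)
               (≈.trans (⨾-resp-≈ identityˡʳ ≈.refl) (⨾-resp-≈ ≈.refl (≈.sym identityˡʳ)))))

  ≈[]-tr : {s s' x y x' y' X Y X' Y' : Obj} → s ≡ s' →
           (a : X ≡ s ⊗₀ x) (b : Y ≡ s ⊗₀ y) (a' : X' ≡ s' ⊗₀ x') (b' : Y' ≡ s' ⊗₀ y')
           {p : x ≡ x'} {q : y ≡ y'} {r : X ≡ X'} {t : Y ≡ Y'} {k : X ⇒ Y} {k' : X' ⇒ Y'} →
           k ≈[ r ∣ t ] k' → tr[ a , b ] k ≈[ p ∣ q ] tr[ a' , b' ] k'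
  ≈[]-tr refl refl refl refl refl {refl} {refl} {refl} {refl} k≈k' =
    ≈-to-≈[] (tr[]-resp-≈ refl refl (≈[]-to-≈ k≈k'))

module Free {ℓ : Level} (C : SMC ℓ) where
  private module C = SMC C
  open C using (Obj; _⊗₀_; I)

  infixr 9 _⨾ᵗ_
  infixr 10 _⊗ᵗ_
  data Term : Obj → Obj → Set ℓ where
    ⌜_⌝  : {A B : Obj} → A C.⇒ B → Term A B
    idᵗ  : {A : Obj} → Term A A
    _⨾ᵗ_ : {A B E : Obj} → Term A B → Term B E → Term A E
    _⊗ᵗ_ : {A B E K : Obj} → Term A B → Term E K → Term (A ⊗₀ E) (B ⊗₀ K)
    σᵗ   : {A B : Obj} → Term (A ⊗₀ B) (B ⊗₀ A)
    trᵗ  : {S X Y : Obj} → Term (S ⊗₀ X) (S ⊗₀ Y) → Term X Y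

  ≡⇒ᵗ : {A B : Obj} → A ≡ B → Term A B
  ≡⇒ᵗ refl = idᵗ

  infix 4 _~_
  data _~_ : {A B : Obj} → Term A B → Term A B → Set ℓ where
    ~-refl  : {A B : Obj} {f : Term A B} → f ~ f
    ~-sym   : {A B : Obj} {f g : Term A B} → f ~ g → g ~ f
    ~-trans : {A B : Obj} {f g h : Term A B} → f ~ g → g ~ h → f ~ h
    ⨾-resp  : {A B E : Obj} {f f' : Term A B} {g g' : Term B E} →
              f ~ f' → g ~ g' → f ⨾ᵗ g ~ f' ⨾ᵗ g'
    identityˡ : {A B : Obj} {f : Term A B} → idᵗ ⨾ᵗ f ~ f
    identityʳ : {A B : Obj} {f : Term A B} → f ⨾ᵗ idᵗ ~ f
    assoc   : {A B E K : Obj} {f : Term A B} {g : Term B E} {h : Term E K} →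
              (f ⨾ᵗ g) ⨾ᵗ h ~ f ⨾ᵗ (g ⨾ᵗ h)
    ⊗-resp  : {A B E K : Obj} {f f' : Term A B} {g g' : Term E K} →
              f ~ f' → g ~ g' → f ⊗ᵗ g ~ f' ⊗ᵗ g'
    ⊗-id    : {A B : Obj} → idᵗ {A} ⊗ᵗ idᵗ {B} ~ idᵗ
    ⊗-⨾     : {A B E K L M : Obj} {f : Term A B} {g : Term B E} {h : Term K L} {k : Term L M} →
              (f ⨾ᵗ g) ⊗ᵗ (h ⨾ᵗ k) ~ (f ⊗ᵗ h) ⨾ᵗ (g ⊗ᵗ k)
    ⊗-assoc₁ : {A B E K L M : Obj} {f : Term A B} {g : Term E K} {h : Term L M} →
               ≡⇒ᵗ (sym C.⊗-assoc₀) ⨾ᵗ ((f ⊗ᵗ g) ⊗ᵗ h) ⨾ᵗ ≡⇒ᵗ C.⊗-assoc₀ ~ f ⊗ᵗ (g ⊗ᵗ h)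
    unitˡ₁  : {A B : Obj} {f : Term A B} →
              ≡⇒ᵗ (sym C.unitˡ₀) ⨾ᵗ (idᵗ {I} ⊗ᵗ f) ⨾ᵗ ≡⇒ᵗ C.unitˡ₀ ~ f
    unitʳ₁  : {A B : Obj} {f : Term A B} →
              ≡⇒ᵗ (sym C.unitʳ₀) ⨾ᵗ (f ⊗ᵗ idᵗ {I}) ⨾ᵗ ≡⇒ᵗ C.unitʳ₀ ~ f
    σ-natural : {A B E K : Obj} {f : Term A B} {g : Term E K} → (f ⊗ᵗ g) ⨾ᵗ σᵗ ~ σᵗ ⨾ᵗ (g ⊗ᵗ f)
    σ-involutive : {A B : Obj} → σᵗ {A} {B} ⨾ᵗ σᵗ {B} {A} ~ idᵗ
    σ-hexagon : {A B E : Obj} →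
                σᵗ {A} {B ⊗₀ E} ~
                ≡⇒ᵗ (sym C.⊗-assoc₀) ⨾ᵗ (σᵗ {A} {B} ⊗ᵗ idᵗ {E}) ⨾ᵗ ≡⇒ᵗ C.⊗-assoc₀
                  ⨾ᵗ (idᵗ {B} ⊗ᵗ σᵗ {A} {E}) ⨾ᵗ ≡⇒ᵗ (sym C.⊗-assoc₀)
    tr-resp : {S X Y : Obj} {f g : Term (S ⊗₀ X) (S ⊗₀ Y)} → f ~ g → trᵗ f ~ trᵗ g
    tightening : {S X X' Y Y' : Obj} (u : Term X' X) (f : Term (S ⊗₀ X) (S ⊗₀ Y)) (v : Term Y Y') →
                 trᵗ ((idᵗ {S} ⊗ᵗ u) ⨾ᵗ f ⨾ᵗ (idᵗ {S} ⊗ᵗ v)) ~ u ⨾ᵗ trᵗ f ⨾ᵗ v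
    strength : {S X Y Z W : Obj} (f : Term (S ⊗₀ X) (S ⊗₀ Y)) (g : Term Z W) →
               trᵗ {S} (≡⇒ᵗ (sym C.⊗-assoc₀) ⨾ᵗ (f ⊗ᵗ g) ⨾ᵗ ≡⇒ᵗ C.⊗-assoc₀) ~ trᵗ f ⊗ᵗ g
    joining : {S T X Y : Obj} (f : Term (S ⊗₀ (T ⊗₀ X)) (S ⊗₀ (T ⊗₀ Y))) →
              trᵗ {T} (trᵗ {S} f) ~ trᵗ {S ⊗₀ T} (≡⇒ᵗ C.⊗-assoc₀ ⨾ᵗ f ⨾ᵗ ≡⇒ᵗ (sym C.⊗-assoc₀))
    vanishing : {X Y : Obj} (f : Term (I ⊗₀ X) (I ⊗₀ Y)) →
                trᵗ {I} f ~ ≡⇒ᵗ (sym C.unitˡ₀) ⨾ᵗ f ⨾ᵗ ≡⇒ᵗ C.unitˡ₀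
    sliding : {S T X Y : Obj} (f : Term (T ⊗₀ X) (S ⊗₀ Y)) (u : Term S T) →
              trᵗ {T} (f ⨾ᵗ (u ⊗ᵗ idᵗ {Y})) ~ trᵗ {S} ((u ⊗ᵗ idᵗ {X}) ⨾ᵗ f)
    yanking : {S : Obj} → trᵗ {S} (σᵗ {S} {S}) ~ idᵗ {S}
    uniform : {S T X Y : Obj} (f : Term (S ⊗₀ X) (S ⊗₀ Y)) (g : Term (T ⊗₀ X) (T ⊗₀ Y))
              (r : Term S T) → f ⨾ᵗ (r ⊗ᵗ idᵗ {Y}) ~ (r ⊗ᵗ idᵗ {X}) ⨾ᵗ g → trᵗ f ~ trᵗ g
    ⌜⌝-resp : {A B : Obj} {f g : A C.⇒ B} → f C.≈ g → ⌜ f ⌝ ~ ⌜ g ⌝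
    ⌜⌝-id   : {A : Obj} → ⌜ C.id {A} ⌝ ~ idᵗ
    ⌜⌝-⨾    : {A B E : Obj} {f : A C.⇒ B} {g : B C.⇒ E} → ⌜ f C.⨾ g ⌝ ~ ⌜ f ⌝ ⨾ᵗ ⌜ g ⌝
    ⌜⌝-⊗    : {A B E K : Obj} {f : A C.⇒ B} {g : E C.⇒ K} → ⌜ f C.⊗₁ g ⌝ ~ ⌜ f ⌝ ⊗ᵗ ⌜ g ⌝
    ⌜⌝-σ    : {A B : Obj} → ⌜ C.σ {A} {B} ⌝ ~ σᵗ

  freeCategory : Category ℓ
  freeCategory = record
    { Obj = Obj ; Obj-isSet = C.Obj-isSet ; _⇒_ = Term ; _≈_ = _~_
    ; ≈-equiv = record { refl = ~-refl ; sym = ~-sym ; trans = ~-trans }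
    ; id = idᵗ ; _⨾_ = _⨾ᵗ_ ; ⨾-resp-≈ = ⨾-resp
    ; identityˡ = identityˡ ; identityʳ = identityʳ ; assoc = assoc }

  ≡⇒-coincide : {A B : Obj} (p : A ≡ B) → Category.≡⇒ freeCategory p ~ ≡⇒ᵗ p
  ≡⇒-coincide refl = ~-refl

  ≡⇒-conj : {A B A' B' : Obj} (p : A ≡ A') (q : B ≡ B') {f : Term A' B} →
            Category.≡⇒ freeCategory p ⨾ᵗ f ⨾ᵗ Category.≡⇒ freeCategory q ~ ≡⇒ᵗ p ⨾ᵗ f ⨾ᵗ ≡⇒ᵗ q
  ≡⇒-conj p q = ⨾-resp (≡⇒-coincide p) (⨾-resp ~-refl (≡⇒-coincide q))

  freeSMC : SMC ℓ
  freeSMC = record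
    { category = freeCategory ; _⊗₀_ = _⊗₀_ ; I = I ; _⊗₁_ = _⊗ᵗ_ ; ⊗-resp-≈ = ⊗-resp
    ; ⊗-id = ⊗-id ; ⊗-⨾ = ⊗-⨾
    ; ⊗-assoc₀ = C.⊗-assoc₀ ; unitˡ₀ = C.unitˡ₀ ; unitʳ₀ = C.unitʳ₀
    ; ⊗-assoc₁ = ~-trans (≡⇒-conj _ _) ⊗-assoc₁
    ; unitˡ₁ = ~-trans (≡⇒-conj _ _) unitˡ₁
    ; unitʳ₁ = ~-trans (≡⇒-conj _ _) unitʳ₁
    ; σ = σᵗ ; σ-natural = σ-natural ; σ-involutive = σ-involutive
    ; σ-hexagon = ~-trans σ-hexagon (~-sym (⨾-resp (≡⇒-coincide _) (⨾-resp ~-refl (≡⇒-conj _ _))))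
    }

  freeUTSMC : UTSMC ℓ
  freeUTSMC = record
    { smc = freeSMC ; tr = trᵗ ; tr-resp-≈ = tr-resp ; tightening = tightening
    ; strength = λ f g → ~-trans (tr-resp (≡⇒-conj _ _)) (strength f g)
    ; joining = λ f → ~-trans (joining f) (~-sym (tr-resp (≡⇒-conj _ _)))
    ; vanishing = λ f → ~-trans (vanishing f) (~-sym (≡⇒-conj _ _))
    ; sliding = sliding ; yanking = yanking ; uniform = uniform }

  η : SMFunctor C freeSMC
  η = record
    { F₀ = λ A → A ; F₁ = ⌜_⌝ ; F-resp = ⌜⌝-resp ; F-id = ⌜⌝-id ; F-⨾ = ⌜⌝-⨾
    ; F-⊗₀ = refl ; F-I = refl
    ; F-⊗₁ = ~-trans ⌜⌝-⊗ (~-sym (~-trans identityˡ identityʳ))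
    ; F-σ = ~-trans ⌜⌝-σ (~-sym (~-trans identityˡ identityʳ)) }

  module Interpretation (D : UTSMC ℓ) (G : SMFunctor C (UTSMC.smc D)) where
    private
      module D = UTSMC D
      module G = SMFunctor G
    open Transport D.smc
    open TraceTransport D
    open G using (F₀)

    ⟦_⟧ : {A B : Obj} → Term A B → F₀ A D.⇒ F₀ B
    ⟦ ⌜ f ⌝ ⟧  = G.F₁ f
    ⟦ idᵗ ⟧    = D.id
    ⟦ f ⨾ᵗ g ⟧ = ⟦ f ⟧ D.⨾ ⟦ g ⟧
    ⟦ f ⊗ᵗ g ⟧ = ⊗[ G.F-⊗₀ , G.F-⊗₀ ] ⟦ f ⟧ ⟦ g ⟧
    ⟦ σᵗ ⟧     = σ[ G.F-⊗₀ , G.F-⊗₀ ]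
    ⟦ trᵗ f ⟧  = tr[ G.F-⊗₀ , G.F-⊗₀ ] ⟦ f ⟧

    ⟦≡⇒ᵗ⟧ : {A B : Obj} (p : A ≡ B) → ⟦ ≡⇒ᵗ p ⟧ ≡ D.≡⇒ (cong F₀ p)
    ⟦≡⇒ᵗ⟧ refl = refl

    ⟦⟧-resp : {A B : Obj} {f g : Term A B} → f ~ g → ⟦ f ⟧ D.≈ ⟦ g ⟧
    ⟦⟧-resp ~-refl          = ≈.refl
    ⟦⟧-resp (~-sym p)       = ≈.sym (⟦⟧-resp p)
    ⟦⟧-resp (~-trans p q)   = ≈.trans (⟦⟧-resp p) (⟦⟧-resp q)
    ⟦⟧-resp (⨾-resp p q)    = D.⨾-resp-≈ (⟦⟧-resp p) (⟦⟧-resp q)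
    ⟦⟧-resp identityˡ       = D.identityˡ
    ⟦⟧-resp identityʳ       = D.identityʳ
    ⟦⟧-resp assoc           = D.assoc
    ⟦⟧-resp (⊗-resp p q)    = ⊗[]-resp-≈ G.F-⊗₀ G.F-⊗₀ (⟦⟧-resp p) (⟦⟧-resp q)
    ⟦⟧-resp ⊗-id            = ⊗[]-id G.F-⊗₀
    ⟦⟧-resp (⊗-⨾ {f = f} {g} {h} {k}) = ⊗[]-⨾ G.F-⊗₀ G.F-⊗₀ G.F-⊗₀ ⟦ f ⟧ ⟦ g ⟧ ⟦ h ⟧ ⟦ k ⟧
    ⟦⟧-resp (⊗-assoc₁ {A} {B} {E} {K} {L} {M} {f} {g} {h})
      rewrite ⟦≡⇒ᵗ⟧ (sym (C.⊗-assoc₀ {A} {E} {L})) | ⟦≡⇒ᵗ⟧ (C.⊗-assoc₀ {B} {K} {M}) =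
      ⊗[]-assoc ⟦ f ⟧ ⟦ g ⟧ ⟦ h ⟧ (cong F₀ (sym C.⊗-assoc₀)) (cong F₀ C.⊗-assoc₀)
        G.F-⊗₀ G.F-⊗₀ G.F-⊗₀ G.F-⊗₀ G.F-⊗₀ G.F-⊗₀ G.F-⊗₀ G.F-⊗₀
    ⟦⟧-resp (unitˡ₁ {A} {B} {f}) rewrite ⟦≡⇒ᵗ⟧ (sym (C.unitˡ₀ {A})) | ⟦≡⇒ᵗ⟧ (C.unitˡ₀ {B}) =
      ⊗[]-unitˡ ⟦ f ⟧ G.F-I (cong F₀ (sym C.unitˡ₀)) G.F-⊗₀ G.F-⊗₀ (cong F₀ C.unitˡ₀)
    ⟦⟧-resp (unitʳ₁ {A} {B} {f}) rewrite ⟦≡⇒ᵗ⟧ (sym (C.unitʳ₀ {A})) | ⟦≡⇒ᵗ⟧ (C.unitʳ₀ {B}) =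
      ⊗[]-unitʳ ⟦ f ⟧ G.F-I (cong F₀ (sym C.unitʳ₀)) G.F-⊗₀ G.F-⊗₀ (cong F₀ C.unitʳ₀)
    ⟦⟧-resp (σ-natural {f = f} {g}) = σ[]-natural G.F-⊗₀ G.F-⊗₀ G.F-⊗₀ G.F-⊗₀ ⟦ f ⟧ ⟦ g ⟧
    ⟦⟧-resp σ-involutive = σ[]-involutive G.F-⊗₀ G.F-⊗₀
    ⟦⟧-resp (σ-hexagon {A} {B} {E})
      rewrite ⟦≡⇒ᵗ⟧ (sym (C.⊗-assoc₀ {A} {B} {E})) | ⟦≡⇒ᵗ⟧ (C.⊗-assoc₀ {B} {A} {E})
            | ⟦≡⇒ᵗ⟧ (sym (C.⊗-assoc₀ {B} {E} {A})) =
      σ[]-hexagon G.F-⊗₀ G.F-⊗₀ G.F-⊗₀ G.F-⊗₀ G.F-⊗₀ G.F-⊗₀ G.F-⊗₀ G.F-⊗₀ G.F-⊗₀ G.F-⊗₀ G.F-⊗₀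
        (cong F₀ (sym C.⊗-assoc₀)) (cong F₀ C.⊗-assoc₀) (cong F₀ (sym C.⊗-assoc₀))
    ⟦⟧-resp (tr-resp p) = tr[]-resp-≈ G.F-⊗₀ G.F-⊗₀ (⟦⟧-resp p)
    ⟦⟧-resp (tightening u f v) =
      tr[]-tightening G.F-⊗₀ G.F-⊗₀ G.F-⊗₀ G.F-⊗₀ ⟦ u ⟧ ⟦ f ⟧ ⟦ v ⟧
    ⟦⟧-resp (strength {S} {X} {Y} {Z} {W} f g)
      rewrite ⟦≡⇒ᵗ⟧ (sym (C.⊗-assoc₀ {S} {X} {Z})) | ⟦≡⇒ᵗ⟧ (C.⊗-assoc₀ {S} {Y} {W}) =
      tr[]-strength ⟦ f ⟧ ⟦ g ⟧ G.F-⊗₀ G.F-⊗₀ (cong F₀ (sym C.⊗-assoc₀)) G.F-⊗₀ G.F-⊗₀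
        G.F-⊗₀ G.F-⊗₀ (cong F₀ C.⊗-assoc₀) G.F-⊗₀ G.F-⊗₀
    ⟦⟧-resp (joining {S} {T} {X} {Y} f)
      rewrite ⟦≡⇒ᵗ⟧ (C.⊗-assoc₀ {S} {T} {X}) | ⟦≡⇒ᵗ⟧ (sym (C.⊗-assoc₀ {S} {T} {Y})) =
      tr[]-joining ⟦ f ⟧ G.F-⊗₀ G.F-⊗₀ G.F-⊗₀ G.F-⊗₀ G.F-⊗₀ G.F-⊗₀
        (cong F₀ C.⊗-assoc₀) (cong F₀ (sym C.⊗-assoc₀)) G.F-⊗₀
    ⟦⟧-resp (vanishing {X} {Y} f) rewrite ⟦≡⇒ᵗ⟧ (sym (C.unitˡ₀ {X})) | ⟦≡⇒ᵗ⟧ (C.unitˡ₀ {Y}) =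
      tr[]-vanishing ⟦ f ⟧ G.F-I G.F-⊗₀ G.F-⊗₀ (cong F₀ (sym C.unitˡ₀)) (cong F₀ C.unitˡ₀)
    ⟦⟧-resp (sliding f u) = tr[]-sliding G.F-⊗₀ G.F-⊗₀ G.F-⊗₀ G.F-⊗₀ ⟦ f ⟧ ⟦ u ⟧
    ⟦⟧-resp yanking = tr[]-yanking G.F-⊗₀
    ⟦⟧-resp (uniform f g r p) =
      tr[]-uniform G.F-⊗₀ G.F-⊗₀ G.F-⊗₀ G.F-⊗₀ ⟦ f ⟧ ⟦ g ⟧ ⟦ r ⟧ (⟦⟧-resp p)
    ⟦⟧-resp (⌜⌝-resp p) = G.F-resp p
    ⟦⟧-resp ⌜⌝-id       = G.F-id
    ⟦⟧-resp ⌜⌝-⨾        = G.F-⨾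
    ⟦⟧-resp ⌜⌝-⊗        = G.F-⊗₁
    ⟦⟧-resp ⌜⌝-σ        = G.F-σ

    lift : TFunctor freeUTSMC D
    lift = record
      { smf = record
        { F₀ = F₀ ; F₁ = ⟦_⟧ ; F-resp = ⟦⟧-resp ; F-id = ≈.refl ; F-⨾ = ≈.refl
        ; F-⊗₀ = G.F-⊗₀ ; F-I = G.F-I ; F-⊗₁ = ≈.refl ; F-σ = ≈.refl }
      ; F-tr = ≈.refl }

    lift-factors : Factors η lift G
    lift-factors = (λ A → refl) , λ f → ≈.trans D.identityʳ (≈.sym D.identityˡ)

    lift-unique : (H : TFunctor freeUTSMC D) → Factors η H G → _≐_ freeUTSMC D H lift
    lift-unique H (e , H∘η≈G) = e , λ t → commutes (agrees t)
      where
        module H = TFunctor H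
        agrees : {A B : Obj} (t : Term A B) → H.F₁ t ≈[ e A ∣ e B ] ⟦ t ⟧
        agrees ⌜ f ⌝    = square (H∘η≈G f)
        agrees {A} idᵗ = ≈[]-respˡ H.F-id (≈[]-id (e A))
        agrees (f ⨾ᵗ g) = ≈[]-respˡ H.F-⨾ (≈[]-⨾ (agrees f) (agrees g))
        agrees (f ⊗ᵗ g) =
          ≈[]-respˡ H.F-⊗₁ (≈[]-⊗ H.F-⊗₀ H.F-⊗₀ G.F-⊗₀ G.F-⊗₀ (agrees f) (agrees g))
        agrees (σᵗ {A} {B}) =
          ≈[]-respˡ H.F-σ (≈[]-σ H.F-⊗₀ H.F-⊗₀ G.F-⊗₀ G.F-⊗₀ (e A) (e B))
        agrees (trᵗ {S} f) =
          ≈[]-respˡ H.F-tr (≈[]-tr (e S) H.F-⊗₀ H.F-⊗₀ G.F-⊗₀ G.F-⊗₀ (agrees f))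

  universalArrow : UniversalArrow C
  universalArrow = record
    { F = freeUTSMC ; η = η
    ; factor = Interpretation.lift
    ; factors = Interpretation.lift-factors
    ; unique = Interpretation.lift-unique }

theorem4p7 : (ℓ : Level) → ForgetfulHasLeftAdjoint ℓ
theorem4p7 _ = Free.universalArrow
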